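{- Let $G$ be a finite complete group, let $g\in G$ be an involution, let $\sigma(g)$ be the inner automorphism $h\mapsto ghg^{ -1}$, and let $S\subseteq G$ be a generalized Cayley subset of $G$ induced by $\sigma(g)$. Then for any $x\in N_G(S)=\{y\in G\mid Sy=yS\}$, $$GC(G,S,\sigma(g))\cong GC(G,[g,x]S,\sigma(g)),$$ where $[g,x]=g^{ -1}x^{ -1}gx$, $[g,x]S=\{[g,x]s\mid s\in S\}$ and $\cong$ denotes graph isomorphism.
   Context: A group $G$ is complete if $Z(G)=\{e\}$ and $\mathrm{Aut}(G)=\mathrm{Inn}(G)$. An involution is an element of order $2$. For $y\in G$ and $\alpha\in\mathrm{Aut}(G)$, $y^\alpha$ denotes the image of $y$ under $\alpha$. Generalized Cayley graphs: given a finite group $G$, an automorphism $\alpha\in\mathrm{Aut}(G)$ and $S\subseteq G$, suppose (a) $\alpha^2=\mathrm{id}$; (b) for every $y\in G$, $(y^{ -1})^\alpha y\notin S$; (c) for all $y,h\in G$, if $(h^{ -1})^\alpha y\in S$ then $(y^{ -1})^\alpha h\in S$. Then $S$ is called a generalized Cayley subset of $G$ induced by $\alpha$, and $GC(G,S,\alpha)$ is the graph with vertex set $G$ and edge set $\{\{y,h\}\mid (y^{ -1})^\alpha h\in S\}$. Writing $GC(G,S,\alpha)$ includes the assertion that $S$ is a generalized Cayley subset induced by $\alpha$. -}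

module Defs where

open import Level using (Level; suc; _⊔_)
open import Algebra.Bundles using (Group)
open import Algebra.Morphism.Structures using (module GroupMorphisms)
import Algebra.Definitions.RawMonoid as RawMonoidDefs
import Algebra.Properties.Group as GroupProperties
open import Data.Fin.Base using (Fin)
import Data.Nat.Base as ℕ
open import Data.Nat.Base using (ℕ)
open import Data.Product.Base using (∃; ∃-syntax; Σ-syntax; _×_; _,_)
open import Function.Bundles using (Inverse; _⇔_)
open import Relation.Binary.Bundles using (Setoid)
open import Relation.Binary.Core using (Rel)
open import Relation.Binary.Definitions using (Symmetric; _Respects_; _Respects₂_)
import Relation.Binary.PropositionalEquality.Properties as ≡
open import Relation.Nullary.Negation using (¬_)
open import Relation.Unary using (Pred; _∈_; _∉_; _≐_)
import Relation.Binary.Reasoning.Setoid as SetoidReasoning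

IsFinite : ∀ {a ℓ : Level} → Setoid a ℓ → Set (a ⊔ ℓ)
IsFinite A = ∃[ n ] Inverse A (≡.setoid (Fin n))

-- Simple undirected graphs; vertices are taken up to the setoid equality.
record Graph (v ℓ e : Level) : Set (suc (v ⊔ ℓ ⊔ e)) where
  field
    vertices : Setoid v ℓ
  open Setoid vertices using (_≈_) renaming (Carrier to Vertex) public
  field
    Adj      : Rel Vertex e
    resp-≈   : Adj Respects₂ _≈_
    sym      : Symmetric Adj
    loopless : ∀ {y h} → y ≈ h → ¬ Adj y h

infix 4 _≅_

record _≅_ {v₁ ℓ₁ e₁ v₂ ℓ₂ e₂ : Level}
           (Γ : Graph v₁ ℓ₁ e₁) (Δ : Graph v₂ ℓ₂ e₂)
           : Set (v₁ ⊔ ℓ₁ ⊔ e₁ ⊔ v₂ ⊔ ℓ₂ ⊔ e₂) where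
  private
    module Γ = Graph Γ
    module Δ = Graph Δ
  field
    bijection : Inverse Γ.vertices Δ.vertices
  open Inverse bijection using (to) public
  field
    adj-iff : ∀ y h → Γ.Adj y h ⇔ Δ.Adj (to y) (to h)

module GroupNotions {c ℓ : Level} (G : Group c ℓ) where
  open Group G
  open GroupMorphisms rawGroup rawGroup using (IsGroupIsomorphism)
  -- `n × x` of the library is the n-th power of x.
  open RawMonoidDefs rawMonoid using () renaming (_×_ to pow)
  open GroupProperties G

  record Automorphism : Set (c ⊔ ℓ) where
    field
      ⟦_⟧           : Carrier → Carrier
      isIsomorphism : IsGroupIsomorphism ⟦_⟧
    open IsGroupIsomorphism isIsomorphism public using (⟦⟧-cong; ∙-homo; ⁻¹-homo)

  open Automorphism using (⟦_⟧)

  private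
    conj-homo : ∀ g x y → g ∙ (x ∙ y) ∙ g ⁻¹ ≈ (g ∙ x ∙ g ⁻¹) ∙ (g ∙ y ∙ g ⁻¹)
    conj-homo g x y = sym (begin
      (g ∙ x ∙ g ⁻¹) ∙ (g ∙ y ∙ g ⁻¹)   ≈⟨ assoc _ _ _ ⟨
      ((g ∙ x ∙ g ⁻¹) ∙ (g ∙ y)) ∙ g ⁻¹ ≈⟨ ∙-congʳ (assoc _ _ _) ⟩
      ((g ∙ x) ∙ (g ⁻¹ ∙ (g ∙ y))) ∙ g ⁻¹ ≈⟨ ∙-congʳ (∙-congˡ (\\-leftDividesʳ g y)) ⟩
      ((g ∙ x) ∙ y) ∙ g ⁻¹              ≈⟨ ∙-congʳ (assoc _ _ _) ⟩
      g ∙ (x ∙ y) ∙ g ⁻¹                ∎)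
      where open SetoidReasoning setoid

    conj-ε : ∀ g → g ∙ ε ∙ g ⁻¹ ≈ ε
    conj-ε g = trans (∙-congʳ (identityʳ g)) (inverseʳ g)

    conj-⁻¹ : ∀ g x → g ∙ x ⁻¹ ∙ g ⁻¹ ≈ (g ∙ x ∙ g ⁻¹) ⁻¹
    conj-⁻¹ g x = inverseʳ-unique _ _
      (trans (sym (conj-homo g x (x ⁻¹)))
        (trans (∙-congʳ (∙-congˡ (inverseʳ x))) (conj-ε g)))

    conj-section : ∀ g x → g ∙ (g ⁻¹ ∙ x ∙ g) ∙ g ⁻¹ ≈ x
    conj-section g x =
      trans (∙-congʳ (trans (sym (assoc _ _ _)) (∙-congʳ (\\-leftDividesˡ g x))))
            (//-rightDividesʳ g x)

  σ : Carrier → Automorphism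
  σ g = record
    { ⟦_⟧ = λ h → g ∙ h ∙ g ⁻¹
    ; isIsomorphism = record
      { isGroupMonomorphism = record
        { isGroupHomomorphism = record
          { isMonoidHomomorphism = record
            { isMagmaHomomorphism = record
              { isRelHomomorphism = record { cong = λ x≈y → ∙-congʳ (∙-congˡ x≈y) }
              ; homo = conj-homo g
              }
            ; ε-homo = conj-ε g
            }
          ; ⁻¹-homo = conj-⁻¹ g
          }
        ; injective = λ eq → ∙-cancelˡ g _ _ (∙-cancelʳ (g ⁻¹) _ _ eq)
        }
      ; surjective = λ x → (g ⁻¹ ∙ x ∙ g) ,
          λ z≈ → trans (∙-congʳ (∙-congˡ z≈)) (conj-section g x)
      }
    }

  Centre : Pred Carrier (c ⊔ ℓ)
  Centre z = ∀ h → z ∙ h ≈ h ∙ z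

  IsInner : Pred Automorphism (c ⊔ ℓ)
  IsInner α = ∃[ g ] (∀ h → ⟦ α ⟧ h ≈ ⟦ σ g ⟧ h)

  -- Inn(G) ⊆ Aut(G) is the typing of σ, so Aut(G) = Inn(G) is the other inclusion.
  record IsComplete : Set (c ⊔ ℓ) where
    field
      centre-trivial : Centre ≐ (_≈ ε)
      all-inner      : ∀ α → IsInner α

  record HasOrder (x : Carrier) (n : ℕ) : Set ℓ where
    field
      positive : 0 ℕ.< n
      pow≈ε    : pow n x ≈ ε
      minimal  : ∀ m → 0 ℕ.< m → m ℕ.< n → ¬ (pow m x ≈ ε)

  IsInvolution : Pred Carrier ℓ
  IsInvolution g = HasOrder g 2

  ⁅_,_⁆ : Carrier → Carrier → Carrier
  ⁅ g , x ⁆ = g ⁻¹ ∙ x ⁻¹ ∙ g ∙ x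

  -- Subsets must respect the group's equality; no decidability is assumed.
  record Subset (p : Level) : Set (c ⊔ ℓ ⊔ suc p) where
    field
      member : Pred Carrier p
      resp   : member Respects _≈_

  open Subset using (member; resp)

  infixr 8 _∙ˡ_
  infixl 8 _∙ʳ_

  _∙ˡ_ : ∀ {p : Level} → Carrier → Subset p → Subset (c ⊔ ℓ ⊔ p)
  x ∙ˡ S = record
    { member = λ z → ∃[ s ] (s ∈ member S × z ≈ x ∙ s)
    ; resp   = λ { z≈w (s , s∈S , z≈xs) → s , s∈S , trans (sym z≈w) z≈xs }
    }

  _∙ʳ_ : ∀ {p : Level} → Subset p → Carrier → Subset (c ⊔ ℓ ⊔ p)
  S ∙ʳ x = record
    { member = λ z → ∃[ s ] (s ∈ member S × z ≈ s ∙ x)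
    ; resp   = λ { z≈w (s , s∈S , z≈sx) → s , s∈S , trans (sym z≈w) z≈sx }
    }

  Normalizer : ∀ {p : Level} → Subset p → Pred Carrier (c ⊔ ℓ ⊔ p)
  Normalizer S y = member (S ∙ʳ y) ≐ member (y ∙ˡ S)

  record IsGeneralizedCayleySubset {p : Level} (α : Automorphism) (S : Subset p)
         : Set (c ⊔ ℓ ⊔ p) where
    field
      α²≈id     : ∀ y → ⟦ α ⟧ (⟦ α ⟧ y) ≈ y
      no-loops  : ∀ y → ⟦ α ⟧ (y ⁻¹) ∙ y ∉ member S
      symmetric : ∀ y h → ⟦ α ⟧ (h ⁻¹) ∙ y ∈ member S → ⟦ α ⟧ (y ⁻¹) ∙ h ∈ member S

  -- The edge {y , h} is unordered; `symmetric` makes the condition below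
  -- independent of the order of its endpoints.
  GC : ∀ {p : Level} (S : Subset p) (α : Automorphism) →
       IsGeneralizedCayleySubset α S → Graph c ℓ p
  GC S α gc = record
    { vertices = setoid
    ; Adj      = λ y h → ⟦ α ⟧ (y ⁻¹) ∙ h ∈ member S
    ; resp-≈   = (λ h≈h′ → resp S (∙-congˡ h≈h′))
               , (λ y≈y′ → resp S (∙-congʳ (α.⟦⟧-cong (⁻¹-cong y≈y′))))
    ; sym      = λ {y} {h} → symmetric h y
    ; loopless = λ {y} {h} y≈h adj → no-loops y (resp S (∙-congˡ (sym y≈h)) adj)
    }
    where
      module α = Automorphism α
      open IsGeneralizedCayleySubset gc

{-# OPTIONS --safe #-}

-- Since g⁻¹ = g, right translation by x turns the quotient s = (y⁻¹)^σ(g) h into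
-- ((y x)⁻¹)^σ(g) (h x) = [g,x] x⁻¹ s x, and x⁻¹ S x = S because x normalizes S.
-- So y ↦ y x carries the edges induced by S onto those induced by [g,x]S, and as
-- it is onto G, the axioms of a generalized Cayley subset carry over as well.
module Submission where

open import Defs
open import Level using (Level)
open import Algebra.Bundles using (Group)
import Algebra.Properties.Group as GroupProperties
open import Data.Product.Base using (Σ-syntax; _,_)
open import Function.Bundles using (Inverse; _⇔_; Equivalence; mk⇔)
open import Relation.Binary.Core using (Rel)
import Relation.Binary.Reasoning.Setoid as SetoidReasoning
open import Relation.Unary using (_∈_)
open import Tactic.MonoidSolver using (solve)

module _ {c ℓ : Level} (G : Group c ℓ) where
  open Group G
  open GroupNotions G
  open GroupProperties G
  open Subset using (member; resp)
  open Automorphism using (⟦_⟧)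
  open SetoidReasoning setoid

  right-translation : Carrier → Inverse setoid setoid
  right-translation x = record
    { to        = _∙ x
    ; from      = _∙ x ⁻¹
    ; to-cong   = ∙-congʳ
    ; from-cong = ∙-congʳ
    ; inverse   = (λ y≈ → trans (∙-congʳ y≈) (//-rightDividesˡ x _))
                , (λ y≈ → trans (∙-congʳ y≈) (//-rightDividesʳ x _))
    }

  involution-self-inverse : ∀ {g} → IsInvolution g → g ⁻¹ ≈ g
  involution-self-inverse {g} g-inv =
    -- Here `pow≈ε` unfolds to `g ∙ (g ∙ ε) ≈ ε`, so the trailing `ε` is removed first.
    sym (inverseʳ-unique g g (trans (sym (∙-congˡ (identityʳ g))) pow≈ε))
    where open HasOrder g-inv

  -- The commutator is assembled by inserting trivial products behind `g ⁻¹ ∙ x ⁻¹`. The last factor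
  -- is bracketed as `x ⁻¹ ∙ (s ∙ x)`, with `s` the old quotient, to fit `∈-conjugate`.
  quotient-translate : ∀ {g} → g ⁻¹ ≈ g → ∀ x y h →
    ⟦ σ g ⟧ ((y ∙ x) ⁻¹) ∙ (h ∙ x) ≈
    ⁅ g , x ⁆ ∙ (x ⁻¹ ∙ (⟦ σ g ⟧ (y ⁻¹) ∙ h ∙ x))
  quotient-translate {g} g⁻¹≈g x y h = begin
    g ∙ (y ∙ x) ⁻¹ ∙ g ⁻¹ ∙ (h ∙ x)
      ≈⟨ ∙-congʳ (∙-congʳ (∙-cong (sym g⁻¹≈g) (⁻¹-anti-homo-∙ y x))) ⟩
    g ⁻¹ ∙ (x ⁻¹ ∙ y ⁻¹) ∙ g ⁻¹ ∙ (h ∙ x)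
      ≈⟨ reassoc (g ⁻¹) (x ⁻¹) (y ⁻¹) (g ⁻¹) h x ⟩
    g ⁻¹ ∙ x ⁻¹ ∙ (y ⁻¹ ∙ g ⁻¹ ∙ h ∙ x)
      -- The inserted `g ⁻¹ ∙ g` becomes `g ∙ g`: its first `g` goes to the commutator, its second
      -- restores the conjugation in the old quotient.
      ≈⟨ ∙-congˡ (\\-leftDividesʳ g _) ⟨
    g ⁻¹ ∙ x ⁻¹ ∙ (g ⁻¹ ∙ (g ∙ (y ⁻¹ ∙ g ⁻¹ ∙ h ∙ x)))
      ≈⟨ ∙-congˡ (∙-congʳ g⁻¹≈g) ⟩
    g ⁻¹ ∙ x ⁻¹ ∙ (g ∙ (g ∙ (y ⁻¹ ∙ g ⁻¹ ∙ h ∙ x)))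
      ≈⟨ assoc (g ⁻¹ ∙ x ⁻¹) g _ ⟨
    g ⁻¹ ∙ x ⁻¹ ∙ g ∙ (g ∙ (y ⁻¹ ∙ g ⁻¹ ∙ h ∙ x))
      ≈⟨ ∙-congˡ (reassoc′ g (y ⁻¹) (g ⁻¹) h x) ⟩
    g ⁻¹ ∙ x ⁻¹ ∙ g ∙ (g ∙ y ⁻¹ ∙ g ⁻¹ ∙ h ∙ x)
      -- Inserting `x ∙ x ⁻¹` supplies the last letter of `⁅ g , x ⁆` and leaves a conjugate by `x`.
      ≈⟨ ∙-congˡ (\\-leftDividesˡ x _) ⟨
    g ⁻¹ ∙ x ⁻¹ ∙ g ∙ (x ∙ (x ⁻¹ ∙ (g ∙ y ⁻¹ ∙ g ⁻¹ ∙ h ∙ x)))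
      ≈⟨ assoc (g ⁻¹ ∙ x ⁻¹ ∙ g) x _ ⟨
    ⁅ g , x ⁆ ∙ (x ⁻¹ ∙ (g ∙ y ⁻¹ ∙ g ⁻¹ ∙ h ∙ x)) ∎
    where
    reassoc : ∀ a b c d e f → a ∙ (b ∙ c) ∙ d ∙ (e ∙ f) ≈ a ∙ b ∙ (c ∙ d ∙ e ∙ f)
    reassoc a b c d e f = solve monoid
    reassoc′ : ∀ a b c d e → a ∙ (b ∙ c ∙ d ∙ e) ≈ a ∙ b ∙ c ∙ d ∙ e
    reassoc′ a b c d e = solve monoid

  module _ {p : Level} (S : Subset p) where

    ∈-∙ˡ : ∀ {a s} → s ∈ member S ⇔ (a ∙ s) ∈ member (a ∙ˡ S)
    ∈-∙ˡ {a} = mk⇔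
      (λ s∈S → _ , s∈S , refl)
      (λ (t , t∈S , as≈at) → resp S (sym (∙-cancelˡ a _ _ as≈at)) t∈S)

    -- Both directions pass through `s ∙ x`, read as an element of `S ∙ʳ x` or of `x ∙ˡ S`; each
    -- inclusion of the normalizer condition gives one implication after cancelling `x`.
    ∈-conjugate : ∀ {x s} → x ∈ Normalizer S →
      s ∈ member S ⇔ (x ⁻¹ ∙ (s ∙ x)) ∈ member S
    ∈-conjugate {x} {s} (Sx⊆xS , xS⊆Sx) = mk⇔ to from
      where
      to : s ∈ member S → (x ⁻¹ ∙ (s ∙ x)) ∈ member S
      to s∈S =
        let t , t∈S , sx≈xt = Sx⊆xS (s , s∈S , refl)
        in resp S (sym (trans (∙-congˡ sx≈xt) (\\-leftDividesʳ x t))) t∈S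
      from : (x ⁻¹ ∙ (s ∙ x)) ∈ member S → s ∈ member S
      from t∈S =
        let r , r∈S , sx≈rx = xS⊆Sx (_ , t∈S , sym (\\-leftDividesˡ x (s ∙ x)))
        in resp S (sym (∙-cancelʳ x _ _ sx≈rx)) r∈S

  -- The edge relation of `GC` without the proof that `S` is a generalized Cayley subset, so that it
  -- can be used for `⁅ g , x ⁆ ∙ˡ S` before that proof exists.
  Adjacent : ∀ {p} → Automorphism → Subset p → Rel Carrier p
  Adjacent α S y h = ⟦ α ⟧ (y ⁻¹) ∙ h ∈ member S

  Adjacent-resp : ∀ {p} α (S : Subset p) {y y′ h h′} → y ≈ y′ → h ≈ h′ →
    Adjacent α S y h → Adjacent α S y′ h′
  Adjacent-resp α S y≈y′ h≈h′ =
    resp S (∙-cong (Automorphism.⟦⟧-cong α (⁻¹-cong y≈y′)) h≈h′)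

  adjacent-translate : ∀ {p} (S : Subset p) {g x} → g ⁻¹ ≈ g → x ∈ Normalizer S →
    ∀ y h → Adjacent (σ g) S y h ⇔
            Adjacent (σ g) (⁅ g , x ⁆ ∙ˡ S) (y ∙ x) (h ∙ x)
  adjacent-translate S {g} {x} g⁻¹≈g x∈N y h = mk⇔
    (λ a → resp T (sym eq) (∈T.to (∈S.to a)))
    (λ a → ∈S.from (∈T.from (resp T eq a)))
    where
    T = ⁅ g , x ⁆ ∙ˡ S
    eq = quotient-translate g⁻¹≈g x y h
    module ∈S = Equivalence (∈-conjugate S {x} {⟦ σ g ⟧ (y ⁻¹) ∙ h} x∈N)
    module ∈T = Equivalence
      (∈-∙ˡ S {⁅ g , x ⁆} {x ⁻¹ ∙ (⟦ σ g ⟧ (y ⁻¹) ∙ h ∙ x)})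

  -- `no-loops` and `symmetric` say that `Adjacent` is irreflexive and symmetric, which passes along
  -- a bijection preserving and reflecting it; `α²≈id` concerns `α` alone.
  isGeneralizedCayleySubset-transport :
    ∀ {p q} {α} {S : Subset p} {T : Subset q} (φ : Inverse setoid setoid) →
    (∀ y h → Adjacent α S y h ⇔ Adjacent α T (Inverse.to φ y) (Inverse.to φ h)) →
    IsGeneralizedCayleySubset α S → IsGeneralizedCayleySubset α T
  isGeneralizedCayleySubset-transport {α = α} {S} {T} φ adj S-gc = record
    { α²≈id     = S-gc.α²≈id
    ; no-loops  = λ y a → S-gc.no-loops (from y) (pull a)
    ; symmetric = λ y h a → push (S-gc.symmetric (from y) (from h) (pull a))
    }
    where
    module S-gc = IsGeneralizedCayleySubset S-gc
    open Inverse φ using (to; from; strictlyInverseˡ)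
    -- `to (from y)` is only `≈`-equal to `y`, hence the use of `Adjacent-resp`.
    pull : ∀ {y h} → Adjacent α T y h → Adjacent α S (from y) (from h)
    pull {y} {h} a = Equivalence.from (adj (from y) (from h))
      (Adjacent-resp α T (sym (strictlyInverseˡ y)) (sym (strictlyInverseˡ h)) a)
    push : ∀ {y h} → Adjacent α S (from y) (from h) → Adjacent α T y h
    push {y} {h} a = Adjacent-resp α T (strictlyInverseˡ y) (strictlyInverseˡ h)
      (Equivalence.to (adj (from y) (from h)) a)

theorem3p4 :
    ∀ {c ℓ p : Level} (G : Group c ℓ) →
    let open Group G
        open GroupNotions G
    in
    IsFinite setoid →
    IsComplete →
    ∀ (g : Carrier) → IsInvolution g →
    ∀ (S : Subset p) (S-gc : IsGeneralizedCayleySubset (σ g) S) →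
    ∀ (x : Carrier) → x ∈ Normalizer S →
    Σ[ gxS-gc ∈ IsGeneralizedCayleySubset (σ g) (⁅ g , x ⁆ ∙ˡ S) ]
      GC S (σ g) S-gc ≅ GC (⁅ g , x ⁆ ∙ˡ S) (σ g) gxS-gc
theorem3p4 G _ _ g g-inv S S-gc x x∈N =
  -- The equivalence `adj` serves twice: to make the target graph well defined, and as the edge
  -- condition of the isomorphism.
  isGeneralizedCayleySubset-transport G {α = GroupNotions.σ G g} {S = S} φ adj S-gc ,
  record { bijection = φ ; adj-iff = adj }
  where
  φ = right-translation G x
  adj = adjacent-translate G S (involution-self-inverse G g-inv) x∈N
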